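{- Let $T$ be a full binary tree on $n$ vertices, let $v_0v_1\cdots v_\ell$ be a longest root-to-leaf path of $T$ with $v_0$ the root, and suppose $f$ is a graceful labeling of $T$ that carries the alternating extreme spine assignment on this path, i.e. $f(v_i)=i/2$ for even $i$ and $f(v_i)=n-1-(i-1)/2$ for odd $i$ ($0\le i\le \ell$). Let $$a=\left\lceil\frac{\ell+1}{2}\right\rceil,\qquad b=\left\lfloor\frac{\ell+1}{2}\right\rfloor.$$ Then the set of labels used on the spine vertices $v_0,\dots,v_\ell$ is $$\{0,1,\dots,a-1\}\cup\{n-b,n-b+1,\dots,n-1\},$$ and the spine edges $v_iv_{i+1}$ ($0\le i<\ell$) use exactly the differences $\{n-\ell,n-\ell+1,\dots,n-1\}$. Consequently, all vertices not on the spine are labeled from the middle block $M=\{a,a+1,\dots,n-1-b\}$, and the edges not on the spine realize exactly the differences $\{1,2,\dots,n-\ell-1\}$.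
   Context: A graceful labeling of a tree $T$ with $n$ vertices is a bijection $f:V(T)\to\{0,1,\dots,n-1\}$ such that the set of induced edge labels (differences) $\{|f(u)-f(v)|: uv\in E(T)\}$ equals $\{1,2,\dots,n-1\}$. A full binary tree is a rooted tree in which every non-leaf vertex has exactly two children. Path length is the number of edges, so a root-to-leaf path of length $\ell$ has vertices $v_0,\dots,v_\ell$. The chosen longest root-to-leaf path is called the spine; its edges are the spine edges, and all other edges of $T$ are off-spine edges. -}

module Defs where

open import Data.Fin.Base using (Fin; zero; suc; toℕ; inject₁; fromℕ)
open import Data.Nat.Base using (ℕ; suc; _+_; _∸_; _≤_; _/_; ∣_-_∣)
open import Data.Nat.Divisibility using (_∣_)
open import Data.Product.Base using (_×_; _,_; ∃-syntax; uncurry)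
open import Data.Tree.Binary using (Tree; leaf; node; #nodes; #leaves)
open import Data.Unit.Base using (⊤)
open import Function.Definitions using (Bijective)
open import Level using (0ℓ)
open import Relation.Binary.PropositionalEquality.Core using (_≡_)
open import Relation.Nullary.Negation.Core using (¬_)
open import Relation.Unary using (Pred; _∈_; _≐_; _∩_; ∁)

-- Each `node` has exactly two children and each `leaf` has none.  The two
-- children come with an order, which nothing below depends on.
FullBinaryTree : Set
FullBinaryTree = Tree ⊤ ⊤

order : FullBinaryTree → ℕ
order T = #nodes T + #leaves T

data Vertex : FullBinaryTree → Set where
  root  : ∀ {T} → Vertex T
  left  : ∀ {l x r} → Vertex l → Vertex (node l x r)
  right : ∀ {l x r} → Vertex r → Vertex (node l x r)

infix 4 _⟶_

-- u ⟶ w : w is a child of u.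
data _⟶_ : ∀ {T} → Vertex T → Vertex T → Set where
  root-left  : ∀ {l x r} → root {node l x r} ⟶ left root
  root-right : ∀ {l x r} → root {node l x r} ⟶ right root
  left       : ∀ {l x r} {u w : Vertex l} → u ⟶ w → left {l} {x} {r} u ⟶ left w
  right      : ∀ {l x r} {u w : Vertex r} → u ⟶ w → right {l} {x} {r} u ⟶ right w

IsLeaf : ∀ {T} → Pred (Vertex T) 0ℓ
IsLeaf u = ∀ w → ¬ (u ⟶ w)

-- Every undirected edge is represented once, as the pair (parent , child).
Edges : ∀ T → Pred (Vertex T × Vertex T) 0ℓ
Edges T = uncurry _⟶_

record RootToLeafPath (T : FullBinaryTree) (ℓ : ℕ) : Set where
  field
    vertex : Fin (suc ℓ) → Vertex T
    start  : vertex zero ≡ root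
    step   : ∀ (i : Fin ℓ) → vertex (inject₁ i) ⟶ vertex (suc i)
    end    : IsLeaf (vertex (fromℕ ℓ))

open RootToLeafPath public using (vertex)

IsLongest : ∀ {T ℓ} → RootToLeafPath T ℓ → Set
IsLongest {T} {ℓ} _ = ∀ m → RootToLeafPath T m → m ≤ ℓ

SpineVertices : ∀ {T ℓ} → RootToLeafPath T ℓ → Pred (Vertex T) 0ℓ
SpineVertices p u = ∃[ i ] u ≡ vertex p i

SpineEdges : ∀ {T ℓ} → RootToLeafPath T ℓ → Pred (Vertex T × Vertex T) 0ℓ
SpineEdges p (u , w) = ∃[ i ] (u ≡ vertex p (inject₁ i) × w ≡ vertex p (suc i))

OffSpineEdges : ∀ {T ℓ} → RootToLeafPath T ℓ → Pred (Vertex T × Vertex T) 0ℓ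
OffSpineEdges {T} p = Edges T ∩ ∁ (SpineEdges p)

-- The set {a, a+1, …, b}, empty when b < a.
⟦_⋯_⟧ : ℕ → ℕ → Pred ℕ 0ℓ
⟦ a ⋯ b ⟧ x = a ≤ x × x ≤ b

Labels : ∀ {T n} → (Vertex T → Fin n) → Pred (Vertex T) 0ℓ → Pred ℕ 0ℓ
Labels f S x = ∃[ u ] (u ∈ S × toℕ (f u) ≡ x)

Differences : ∀ {T n} → (Vertex T → Fin n) → Pred (Vertex T × Vertex T) 0ℓ → Pred ℕ 0ℓ
Differences f E d = ∃[ u ] ∃[ w ] ((u , w) ∈ E × ∣ toℕ (f u) - toℕ (f w) ∣ ≡ d)

record IsGraceful {T : FullBinaryTree} {n : ℕ} (f : Vertex T → Fin n) : Set where
  field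
    bijective   : Bijective _≡_ _≡_ f
    differences : Differences f (Edges T) ≐ ⟦ 1 ⋯ n ∸ 1 ⟧

-- No subtraction is truncated when f is a bijection onto Fin n: the ℓ + 1
-- vertices of a root-to-leaf path are distinct, so ℓ + 1 ≤ n.
record AlternatingExtreme {T : FullBinaryTree} {n ℓ : ℕ}
    (f : Vertex T → Fin n) (p : RootToLeafPath T ℓ) : Set where
  field
    even : ∀ i → 2 ∣ toℕ i → toℕ (f (vertex p i)) ≡ toℕ i / 2
    odd  : ∀ i → ¬ (2 ∣ toℕ i) → toℕ (f (vertex p i)) ≡ n ∸ 1 ∸ (toℕ i ∸ 1) / 2

-- The difference of the edge v_i v_{i+1} is n - 1 - i, whatever the parity of
-- i.  Every non-root vertex is the child of exactly one edge, so T has n - 1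
-- edges, and gracefulness makes the n - 1 edge differences pairwise distinct.
-- Hence an off-spine edge cannot repeat a difference of the spine.
module Submission where

open import Defs
open import Data.Fin.Base using (Fin; zero; suc; toℕ; inject₁; fromℕ<; punchOut)
open import Data.Fin.Induction using (<-weakInduction)
open import Data.Fin.Properties using (any?; toℕ<n; toℕ≤pred[n]; toℕ-injective; toℕ-inject₁; toℕ-fromℕ<; punchOut-injective; injective⇒≤) renaming (_≟_ to _≟ᶠ_)
open import Data.Nat.Base using (ℕ; zero; suc; pred; _+_; _*_; _∸_; _/_; _≤_; _<_; z≤n; s≤s; s≤s⁻¹; ∣_-_∣; ⌈_/2⌉; ⌊_/2⌋)
open import Data.Nat.Divisibility using (_∣_; divides)
open import Data.Nat.DivMod using (m*n/n≡m)
open import Data.Nat.Properties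
open import Data.Product.Base using (_×_; _,_; ∃-syntax; proj₁; proj₂)
open import Data.Sum.Base using (_⊎_; inj₁; inj₂; [_,_])
open import Function.Base using (_∘_)
open import Function.Definitions using (Injective)
open import Relation.Binary.PropositionalEquality using (_≡_; _≢_; refl; sym; trans; cong; cong₂; subst; module ≡-Reasoning)
open import Relation.Nullary.Decidable.Core using (yes; no)
open import Relation.Nullary.Negation.Core using (¬_; contradiction)
open import Relation.Unary using (_≐_; _⊆_; _∪_; ∁)

-- Parity, halving and intervals of natural numbers.

even⊎odd : ∀ k → ∃[ q ] (k ≡ q * 2 ⊎ k ≡ suc (q * 2))
even⊎odd zero = 0 , inj₁ refl
even⊎odd (suc k) with even⊎odd k
... | q , inj₁ eq = q , inj₂ (cong suc eq)
... | q , inj₂ eq = suc q , inj₁ (cong suc eq)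

2∤1+q*2 : ∀ q → ¬ (2 ∣ suc (q * 2))
2∤1+q*2 zero    (divides zero ())
2∤1+q*2 zero    (divides (suc r) ())
2∤1+q*2 (suc q) (divides (suc r) eq) =
  2∤1+q*2 q (divides r (suc-injective (suc-injective eq)))

q*2≤m⇒q≤⌊m/2⌋ : ∀ q {m} → q * 2 ≤ m → q ≤ ⌊ m /2⌋
q*2≤m⇒q≤⌊m/2⌋ zero    _              = z≤n
q*2≤m⇒q≤⌊m/2⌋ (suc q) (s≤s (s≤s le)) = s≤s (q*2≤m⇒q≤⌊m/2⌋ q le)

q≤⌊m/2⌋⇒q*2≤m : ∀ q m → q ≤ ⌊ m /2⌋ → q * 2 ≤ m
q≤⌊m/2⌋⇒q*2≤m zero    m             _        = z≤n
q≤⌊m/2⌋⇒q*2≤m (suc q) (suc (suc m)) (s≤s le) = s≤s (s≤s (q≤⌊m/2⌋⇒q*2≤m q m le))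

-- The lower bound excludes `n = 0`, where `pred n` is truncated to 0 and the strict inequality
-- fails.
1≤m≤pred[n]⇒m<n : ∀ {m n} → 1 ≤ m → m ≤ pred n → m < n
1≤m≤pred[n]⇒m<n {n = zero}  (s≤s _) ()
1≤m≤pred[n]⇒m<n {n = suc _} _       le = s≤s le

∣m-[o∸n]∣≡o∸[m+n] : ∀ m n {o} → m + n ≤ o → ∣ m - (o ∸ n) ∣ ≡ o ∸ (m + n)
∣m-[o∸n]∣≡o∸[m+n] m n {o} le = begin
  ∣ m - (o ∸ n) ∣ ≡⟨ m≤n⇒∣m-n∣≡n∸m (m+n≤o⇒m≤o∸n m le) ⟩
  o ∸ n ∸ m       ≡⟨ ∸-+-assoc o n m ⟩
  o ∸ (n + m)     ≡⟨ cong (o ∸_) (+-comm n m) ⟩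
  o ∸ (m + n)     ∎
  where open ≡-Reasoning

N∸q∈topBlock : ∀ N {b q} → q < b → ⟦ suc N ∸ b ⋯ N ⟧ (N ∸ q)
N∸q∈topBlock N {q = q} q<b = ∸-monoʳ-≤ (suc N) q<b , m∸n≤m N q

-- Reflection `x ↦ N ∸ x` is an involution below `N`, so it recovers the offset from the top. The
-- offset indexes odd spine vertices in one use and spine edges in the other.
topBlock⇒N∸q : ∀ N b {x} → ⟦ suc N ∸ b ⋯ N ⟧ x → ∃[ q ] (q < b × N ∸ q ≡ x)
topBlock⇒N∸q N b {x} (lo , hi) = N ∸ x , q<b , m∸[m∸n]≡n hi
  where
  open ≤-Reasoning

  suc[N]≤x+b : suc N ≤ x + b
  suc[N]≤x+b = begin
    suc N           ≤⟨ m≤n+m∸n (suc N) b ⟩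
    b + (suc N ∸ b) ≤⟨ +-monoʳ-≤ b lo ⟩
    b + x           ≡⟨ +-comm b x ⟩
    x + b           ∎

  q<b : N ∸ x < b
  q<b = begin
    suc (N ∸ x) ≡⟨ +-∸-assoc 1 hi ⟨
    suc N ∸ x   ≤⟨ m≤n+o⇒m∸n≤o (suc N) x suc[N]≤x+b ⟩
    b           ∎

-- Pigeonhole arguments.

-- Punching out a missed value would leave an injection from `Fin (suc n)` into `Fin n`.
injective⇒surjective : ∀ {n} (h : Fin n → Fin n) → Injective _≡_ _≡_ h →
                       ∀ y → ∃[ x ] h x ≡ y
injective⇒surjective {suc n} h inj y with any? (λ x → h x ≟ᶠ y)
... | yes hit = hit
... | no miss = contradiction (injective⇒≤ {f = λ x → punchOut (avoids x)}
                  (inj ∘ punchOut-injective (avoids _) (avoids _))) 1+n≰n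
  where
  avoids : ∀ x → y ≢ h x
  avoids x eq = miss (x , sym eq)

-- The injection `f` says that `A` has at most `n` elements, and `δ` takes `n` values on them. A
-- choice of preimages followed by `f` is an injective self-map of `Fin n`, hence onto, so every
-- element of `A` is a chosen preimage.
hitsAll⇒injective : ∀ {A : Set} {n} (f : A → Fin n) → Injective _≡_ _≡_ f →
                    (δ : A → ℕ) → (∀ (d : Fin n) → ∃[ x ] δ x ≡ toℕ d) →
                    Injective _≡_ _≡_ δ
hitsAll⇒injective {A} f f-inj δ hits {x} {y} δx≡δy =
  trans (sym (section-δ x)) (trans (section-cong δx≡δy) (section-δ y))
  where
  section : Fin _ → A
  section d = proj₁ (hits d)

  section-injective : Injective _≡_ _≡_ section
  section-injective {c} {d} eq =
    toℕ-injective (trans (sym (proj₂ (hits c))) (trans (cong δ eq) (proj₂ (hits d))))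

  index : ∀ z → ∃[ d ] f (section d) ≡ f z
  index z = injective⇒surjective (f ∘ section) (section-injective ∘ f-inj) (f z)

  section-δ : ∀ z → section (proj₁ (index z)) ≡ z
  section-δ z = f-inj (proj₂ (index z))

  δ-index : ∀ z → δ z ≡ toℕ (proj₁ (index z))
  δ-index z = trans (cong δ (sym (section-δ z))) (proj₂ (hits _))

  section-cong : δ x ≡ δ y → section (proj₁ (index x)) ≡ section (proj₁ (index y))
  section-cong eq = cong section
    (toℕ-injective (trans (sym (δ-index x)) (trans eq (δ-index y))))

-- Parents and depths in the tree.

-- The root is its own parent, which makes 0 its difference to its parent.
parent : ∀ {T} → Vertex T → Vertex T
parent root              = root
parent (left root)       = root
parent (left (left u))   = left (parent (left u))
parent (left (right u))  = left (parent (right u))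
parent (right root)      = root
parent (right (left u))  = right (parent (left u))
parent (right (right u)) = right (parent (right u))

-- The cases go two levels deep because `parent` reduces only once the second constructor of the
-- child is known.
⟶⇒parent : ∀ {T} {u w : Vertex T} → u ⟶ w → parent w ≡ u
⟶⇒parent root-left            = refl
⟶⇒parent root-right           = refl
⟶⇒parent (left root-left)     = refl
⟶⇒parent (left root-right)    = refl
⟶⇒parent (left e@(left _))    = cong left (⟶⇒parent e)
⟶⇒parent (left e@(right _))   = cong left (⟶⇒parent e)
⟶⇒parent (right root-left)    = refl
⟶⇒parent (right root-right)   = refl
⟶⇒parent (right e@(left _))   = cong right (⟶⇒parent e)
⟶⇒parent (right e@(right _))  = cong right (⟶⇒parent e)

depth : ∀ {T} → Vertex T → ℕ
depth root      = 0
depth (left u)  = suc (depth u)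
depth (right u) = suc (depth u)

⟶⇒depth : ∀ {T} {u w : Vertex T} → u ⟶ w → depth w ≡ suc (depth u)
⟶⇒depth root-left  = refl
⟶⇒depth root-right = refl
⟶⇒depth (left e)   = cong suc (⟶⇒depth e)
⟶⇒depth (right e)  = cong suc (⟶⇒depth e)

module _ {T : FullBinaryTree} {ℓ : ℕ} (p : RootToLeafPath T ℓ) where

  open RootToLeafPath p using (start; step)

  depth-vertex : ∀ i → depth (vertex p i) ≡ toℕ i
  depth-vertex = <-weakInduction (λ i → depth (vertex p i) ≡ toℕ i) (cong depth start)
    (λ i ih → trans (⟶⇒depth (step i)) (cong suc (trans ih (toℕ-inject₁ i))))

  -- Depth increases by one at each step, so it separates the vertices of the path.
  vertex-injective : Injective _≡_ _≡_ (vertex p)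
  vertex-injective {i} {j} eq =
    toℕ-injective (trans (sym (depth-vertex i)) (trans (cong depth eq) (depth-vertex j)))

-- Edge differences of a graceful labeling.

module _ {T : FullBinaryTree} {n : ℕ} {f : Vertex T → Fin n} (graceful : IsGraceful f) where

  open IsGraceful graceful

  label-injective : Injective _≡_ _≡_ f
  label-injective = proj₁ bijective

  parentDifference : Vertex T → ℕ
  parentDifference w = ∣ toℕ (f (parent w)) - toℕ (f w) ∣

  ⟶⇒parentDifference : ∀ {u w} → u ⟶ w → parentDifference w ≡ ∣ toℕ (f u) - toℕ (f w) ∣
  ⟶⇒parentDifference {w = w} e = cong (λ v → ∣ toℕ (f v) - toℕ (f w) ∣) (⟶⇒parent e)

  -- The root supplies 0 and gracefulness the rest, so all `n` values occur on vertices and the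
  -- counting lemma applies without counting edges.
  parentDifference-hitsAll : ∀ (d : Fin n) → ∃[ w ] parentDifference w ≡ toℕ d
  parentDifference-hitsAll zero = root , ∣n-n∣≡0 (toℕ (f root))
  parentDifference-hitsAll (suc d) with proj₂ differences (s≤s z≤n , toℕ<n d)
  ... | u , w , e , eq = w , trans (⟶⇒parentDifference e) eq

  -- Injectivity of `parentDifference` identifies the two children, and a child determines its
  -- parent.
  edge-determined-by-difference :
    ∀ {u w u′ w′} → u ⟶ w → u′ ⟶ w′ →
    ∣ toℕ (f u) - toℕ (f w) ∣ ≡ ∣ toℕ (f u′) - toℕ (f w′) ∣ → (u , w) ≡ (u′ , w′)
  edge-determined-by-difference e e′ eq
    with refl ← hitsAll⇒injective f label-injective parentDifference parentDifference-hitsAll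
                  (trans (⟶⇒parentDifference e) (trans eq (sym (⟶⇒parentDifference e′))))
    with refl ← trans (sym (⟶⇒parent e)) (⟶⇒parent e′) = refl

-- Labels and differences on and off the spine, with `N` for n - 1.

module _ {T : FullBinaryTree} {N ℓ : ℕ} {f : Vertex T → Fin (suc N)}
         {p : RootToLeafPath T ℓ} (graceful : IsGraceful f)
         (alternating : AlternatingExtreme f p) where

  open IsGraceful graceful using (differences)
  open AlternatingExtreme alternating
  open RootToLeafPath p using (step)

  label : Fin (suc ℓ) → ℕ
  label i = toℕ (f (vertex p i))

  label-even : ∀ i q → toℕ i ≡ q * 2 → label i ≡ q
  label-even i q eq =
    trans (even i (divides q eq)) (trans (cong (_/ 2) eq) (m*n/n≡m q 2))

  label-odd : ∀ i q → toℕ i ≡ suc (q * 2) → label i ≡ N ∸ q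
  label-odd i q eq = trans (odd i (2∤1+q*2 q ∘ subst (2 ∣_) eq))
    (cong (N ∸_) (trans (cong (λ k → (k ∸ 1) / 2) eq) (m*n/n≡m q 2)))

  ℓ≤N : ℓ ≤ N
  ℓ≤N = s≤s⁻¹ (injective⇒≤ (vertex-injective p ∘ label-injective graceful))

  spine-labels : Labels f (SpineVertices p) ≐
                 (⟦ 0 ⋯ ⌊ ℓ /2⌋ ⟧ ∪ ⟦ suc N ∸ ⌊ suc ℓ /2⌋ ⋯ N ⟧)
  spine-labels = to , [ fromLow , fromHigh ]
    where
    to : Labels f (SpineVertices p) ⊆ (⟦ 0 ⋯ ⌊ ℓ /2⌋ ⟧ ∪ ⟦ suc N ∸ ⌊ suc ℓ /2⌋ ⋯ N ⟧)
    to (_ , (i , refl) , refl) with even⊎odd (toℕ i)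
    ... | q , inj₁ eq rewrite label-even i q eq =
      inj₁ (z≤n , q*2≤m⇒q≤⌊m/2⌋ q (subst (_≤ ℓ) eq (toℕ≤pred[n] i)))
    ... | q , inj₂ eq rewrite label-odd i q eq =
      -- From 2q + 1 ≤ ℓ follows 2(q + 1) ≤ ℓ + 1, hence q < ⌊(ℓ + 1)/2⌋.
      inj₂ (N∸q∈topBlock N (q*2≤m⇒q≤⌊m/2⌋ (suc q) (s≤s (subst (_≤ ℓ) eq (toℕ≤pred[n] i)))))

    fromLow : ⟦ 0 ⋯ ⌊ ℓ /2⌋ ⟧ ⊆ Labels f (SpineVertices p)
    fromLow {q} (_ , q≤) = vertex p i , (i , refl) , label-even i q (toℕ-fromℕ< bound)
      where
      bound = s≤s (q≤⌊m/2⌋⇒q*2≤m q ℓ q≤)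
      i = fromℕ< bound

    fromHigh : ⟦ suc N ∸ ⌊ suc ℓ /2⌋ ⋯ N ⟧ ⊆ Labels f (SpineVertices p)
    fromHigh x∈ with topBlock⇒N∸q N ⌊ suc ℓ /2⌋ x∈
    ... | q , q< , refl = vertex p i , (i , refl) , label-odd i q (toℕ-fromℕ< bound)
      where
      -- The type `suc q * 2 ≤ suc ℓ` unfolds to `suc (q * 2) < suc ℓ`, so the index is 2q + 1.
      bound = q≤⌊m/2⌋⇒q*2≤m (suc q) (suc ℓ) q<
      i = fromℕ< bound

  -- Consecutive labels come from opposite ends: q and N - q for i = 2q, N - q and q + 1 for i = 2q
  -- + 1. Either way the distances from the two ends add up to i, and i ≤ N prevents truncation.
  spine-difference : ∀ (i : Fin ℓ) → ∣ label (inject₁ i) - label (suc i) ∣ ≡ N ∸ toℕ i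
  spine-difference i with even⊎odd (toℕ i)
  ... | q , inj₁ eq = begin
    ∣ label (inject₁ i) - label (suc i) ∣
      ≡⟨ cong₂ ∣_-_∣ (label-even (inject₁ i) q (trans (toℕ-inject₁ i) eq)) (label-odd (suc i) q (cong suc eq)) ⟩
    ∣ q - (N ∸ q) ∣
      ≡⟨ ∣m-[o∸n]∣≡o∸[m+n] q q (subst (_≤ N) i≡q+q (<⇒≤ (<-≤-trans (toℕ<n i) ℓ≤N))) ⟩
    N ∸ (q + q)
      ≡⟨ cong (N ∸_) i≡q+q ⟨
    N ∸ toℕ i ∎
    where
    open ≡-Reasoning
    i≡q+q : toℕ i ≡ q + q
    i≡q+q = trans eq (trans (*-comm q 2) (cong (q +_) (+-identityʳ q)))
  ... | q , inj₂ eq = begin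
    ∣ label (inject₁ i) - label (suc i) ∣
      ≡⟨ cong₂ ∣_-_∣ (label-odd (inject₁ i) q (trans (toℕ-inject₁ i) eq)) (label-even (suc i) (suc q) (cong suc eq)) ⟩
    ∣ (N ∸ q) - suc q ∣
      ≡⟨ ∣-∣-comm (N ∸ q) (suc q) ⟩
    ∣ suc q - (N ∸ q) ∣
      ≡⟨ ∣m-[o∸n]∣≡o∸[m+n] (suc q) q (subst (_≤ N) i≡1+q+q (<⇒≤ (<-≤-trans (toℕ<n i) ℓ≤N))) ⟩
    N ∸ (suc q + q)
      ≡⟨ cong (N ∸_) i≡1+q+q ⟨
    N ∸ toℕ i ∎
    where
    open ≡-Reasoning
    i≡1+q+q : toℕ i ≡ suc q + q
    i≡1+q+q = trans eq (cong suc (trans (*-comm q 2) (cong (q +_) (+-identityʳ q))))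

  spine-differences : Differences f (SpineEdges p) ≐ ⟦ suc N ∸ ℓ ⋯ N ⟧
  spine-differences = to , from
    where
    to : Differences f (SpineEdges p) ⊆ ⟦ suc N ∸ ℓ ⋯ N ⟧
    to (_ , _ , (i , refl , refl) , refl) =
      subst ⟦ suc N ∸ ℓ ⋯ N ⟧ (sym (spine-difference i)) (N∸q∈topBlock N (toℕ<n i))

    from : ⟦ suc N ∸ ℓ ⋯ N ⟧ ⊆ Differences f (SpineEdges p)
    from d∈ with topBlock⇒N∸q N ℓ d∈
    ... | k , k<ℓ , refl = _ , _ , (fromℕ< k<ℓ , refl , refl) ,
      trans (spine-difference (fromℕ< k<ℓ)) (cong (N ∸_) (toℕ-fromℕ< k<ℓ))

  -- Both extreme blocks are used up by the spine, so injectivity of `f` keeps other vertices out of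
  -- them.
  offSpine-labels : Labels f (∁ (SpineVertices p)) ⊆ ⟦ suc ⌊ ℓ /2⌋ ⋯ N ∸ ⌊ suc ℓ /2⌋ ⟧
  offSpine-labels (u , u∉ , refl) =
      ≰⇒> (λ x≤ → onSpine (inj₁ (z≤n , x≤)))
    , subst (toℕ (f u) ≤_) (pred[m∸n]≡m∸[1+n] (suc N) ⌊ suc ℓ /2⌋)
        (<⇒≤pred (≰⇒> (λ ≤x → onSpine (inj₂ (≤x , toℕ≤pred[n] (f u))))))
    where
    onSpine : ¬ (⟦ 0 ⋯ ⌊ ℓ /2⌋ ⟧ ∪ ⟦ suc N ∸ ⌊ suc ℓ /2⌋ ⋯ N ⟧) (toℕ (f u))
    onSpine x∈ with proj₂ spine-labels x∈
    ... | _ , (i , refl) , eq = u∉ (i , label-injective graceful (toℕ-injective (sym eq)))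

  offSpine-differences : Differences f (OffSpineEdges p) ≐ ⟦ 1 ⋯ suc N ∸ ℓ ∸ 1 ⟧
  offSpine-differences = to , from
    where
    to : Differences f (OffSpineEdges p) ⊆ ⟦ 1 ⋯ suc N ∸ ℓ ∸ 1 ⟧
    to (u , w , (e , ∉spine) , refl) with proj₁ differences (u , w , e , refl)
    -- A difference of at least n - ℓ already occurs on the spine, and equal differences would make
    -- this edge a spine edge.
    ... | 1≤d , d≤N = 1≤d , <⇒≤pred (≰⇒> λ ≤d → onSpine (proj₂ spine-differences (≤d , d≤N)))
      where
      onSpine : ¬ Differences f (SpineEdges p) ∣ toℕ (f u) - toℕ (f w) ∣
      onSpine (_ , _ , (i , refl , refl) , eq)
        with refl ← edge-determined-by-difference graceful (step i) e eq = ∉spine (i , refl , refl)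

    from : ⟦ 1 ⋯ suc N ∸ ℓ ∸ 1 ⟧ ⊆ Differences f (OffSpineEdges p)
    from (1≤d , d≤)
      with proj₂ differences (1≤d , ≤-trans d≤ (∸-monoˡ-≤ 1 (m∸n≤m (suc N) ℓ)))
    ... | u , w , e , eq = u , w , (e , ∉spine) , eq
      where
      ∉spine : ¬ SpineEdges p (u , w)
      ∉spine s = <⇒≱ (1≤m≤pred[n]⇒m<n 1≤d d≤) (proj₁ (proj₁ spine-differences (u , w , s , eq)))

lemma2p3 :
    (T : FullBinaryTree) (n : ℕ) → order T ≡ n →
    (ℓ : ℕ) (spine : RootToLeafPath T ℓ) → IsLongest spine →
    (f : Vertex T → Fin n) → IsGraceful f → AlternatingExtreme f spine →
    let a = ⌈ ℓ + 1 /2⌉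
        b = ⌊ ℓ + 1 /2⌋
    in
      (Labels f (SpineVertices spine) ≐ (⟦ 0 ⋯ a ∸ 1 ⟧ ∪ ⟦ n ∸ b ⋯ n ∸ 1 ⟧))
      × (Differences f (SpineEdges spine) ≐ ⟦ n ∸ ℓ ⋯ n ∸ 1 ⟧)
      × (Labels f (∁ (SpineVertices spine)) ⊆ ⟦ a ⋯ n ∸ 1 ∸ b ⟧)
      × (Differences f (OffSpineEdges spine) ≐ ⟦ 1 ⋯ n ∸ ℓ ∸ 1 ⟧)
lemma2p3 T zero    _ ℓ spine _ f graceful alternating with () ← f root
-- Once `ℓ + 1` is `suc ℓ`, `⌈ suc ℓ /2⌉` computes to `suc ⌊ ℓ /2⌋`, which matches `a` and `a ∸ 1`
-- with the bounds above.
lemma2p3 T (suc N) _ ℓ spine _ f graceful alternating rewrite +-comm ℓ 1 =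
    spine-labels graceful alternating
  , spine-differences graceful alternating
  , offSpine-labels graceful alternating
  , offSpine-differences graceful alternating
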